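{- Let $N\ge 2$ and $m\ge 1$ be integers and let $x^{(r,s)}_k$ ($1\le r,s\le N$, $1\le k\le m$) be elements of a commutative ring; set $x^{(r,s)}_{m+1}=0$ for all $1\le r,s\le N$. Let $G'(N,m)$ be the $Nm\times Nm$ matrix which, as an $N\times N$ block matrix with $m\times m$ blocks, has $(r,s)$ block $$G'_{rs}=\begin{cases}A_m(x^{(r,s)}_1,\dots,x^{(r,s)}_m), & r,s \text{ odd},\\ D_m(x^{(r,s)}_1,\dots,x^{(r,s)}_m), & r \text{ odd},\ s \text{ even},\\ C_m(x^{(r,s)}_1,\dots,x^{(r,s)}_m), & r \text{ even},\ s \text{ odd},\\ B_m(x^{(r,s)}_1,\dots,x^{(r,s)}_m), & r,s \text{ even}.\end{cases}$$ Then $$\det(G'(N,m))=\prod_{i=1}^{m}\det(X_{(i,i+1)}).$$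
   Context: For elements $x_1,\dots,x_m$, the following are $m\times m$ matrices, given by their $(p,q)$ entries: $A_m(x_1,\dots,x_m)$ has entry $x_{m+1-\min(p,q)}$; $B_m(x_1,\dots,x_m)$ has entry $x_{\max(p,q)}$; $C_m(x_1,\dots,x_m)$ has entry $x_{\max(p,\,m+1-q)}$; $D_m(x_1,\dots,x_m)$ has entry $x_{\max(m+1-p,\,q)}$. For $1\le i\le m$, $X_{(i,i+1)}$ is the $N\times N$ matrix whose $(r,s)$ entry is $x^{(r,s)}_i-x^{(r,s)}_{i+1}$. -}

module Defs where

open import Algebra.Bundles using (CommutativeRing)
open import Data.Fin.Base using (Fin; zero; suc; toℕ; punchIn; remQuot)
open import Data.Nat.Base as ℕ using (ℕ; zero; suc; _∸_; _⊓_; _⊔_; parity)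
open import Data.Parity.Base using (Parity; 0ℙ; 1ℙ)
open import Data.Product.Base using (_,_)
open import Data.Vec.Functional using (Vector; foldr; tail)

-- The 1-based position of an index.
pos : ∀ {n} → Fin n → ℕ
pos i = suc (toℕ i)

module Matrices {c ℓ} (R : CommutativeRing c ℓ) where

  open CommutativeRing R hiding (zero)
  open import Algebra.Properties.Semiring.Exp semiring using (_^_)
  open import Algebra.Properties.Semiring.Sum semiring using (sum)

  Matrix : ℕ → Set c
  Matrix n = Fin n → Fin n → Carrier

  -- Cofactor expansion along the first row.
  det : ∀ {n} → Matrix n → Carrier
  det {zero}  M = 1#
  det {suc n} M = sum λ j →
    (- 1#) ^ toℕ j * M zero j * det (λ p q → M (suc p) (punchIn j q))

  product : ∀ {n} → Vector Carrier n → Carrier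
  product = foldr _*_ 1#

  -- x ⟨ k ⟩ is the k-th term, counted from 1, of x₁ , … , xₘ extended by 0;
  -- in particular x ⟨ suc m ⟩ is 0#.
  infix 9 _⟨_⟩
  _⟨_⟩ : ∀ {m} → Vector Carrier m → ℕ → Carrier
  _⟨_⟩ {m}     x zero          = 0#
  _⟨_⟩ {zero}  x (suc k)       = 0#
  _⟨_⟩ {suc m} x (suc zero)    = x zero
  _⟨_⟩ {suc m} x (suc (suc k)) = tail x ⟨ suc k ⟩

  -- In the next four definitions every subscript lies between 1 and m, so the
  -- extension by 0 plays no role.
  A B C D : ∀ {m} → Vector Carrier m → Matrix m
  A {m} x p q = x ⟨ suc m ∸ (pos p ⊓ pos q) ⟩
  B {m} x p q = x ⟨ pos p ⊔ pos q ⟩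
  C {m} x p q = x ⟨ pos p ⊔ (suc m ∸ pos q) ⟩
  D {m} x p q = x ⟨ (suc m ∸ pos p) ⊔ pos q ⟩

  -- x r s is the sequence of the m elements with superscript (r , s).
  X : ∀ {N m} → (Fin N → Fin N → Vector Carrier m) → Fin m → Matrix N
  X x i r s = x r s ⟨ pos i ⟩ - x r s ⟨ suc (pos i) ⟩

  -- The arguments are the parities of the block row and of the block column.
  block : Parity → Parity → ∀ {m} → Vector Carrier m → Matrix m
  block 1ℙ 1ℙ = A
  block 1ℙ 0ℙ = D
  block 0ℙ 1ℙ = C
  block 0ℙ 0ℙ = B

  -- remQuot m splits a (0-based) index r * m + p below N * m into the block
  -- index r and the index p inside the block.
  G′ : ∀ {N m} → (Fin N → Fin N → Vector Carrier m) → Matrix (N ℕ.* m)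
  G′ {N} {m} x i j =
    let r , p = remQuot {N} m i
        s , q = remQuot {N} m j
    in  block (parity (pos r)) (parity (pos s)) (x r s) p q

{-# OPTIONS --safe #-}
module Submission where

-- Reversing the odd block rows and block
-- columns turns every block into x_{max(p,q)} = Σ_i [p ≤ i][q ≤ i](xᵢ − xᵢ₊₁), so
-- G′ = V K Vᵀ, where K is ⊕ᵢ X_(i,i+1) up to the order of the indices and V is
-- block diagonal with each block a staircase matrix ([p ≤ i]), its rows reversed
-- for odd block rows.  Each staircase block has determinant ±1, so (det V)² = 1.
-- Determinants are computed through the uniqueness principle: an alternating
-- row-multilinear function D satisfies D M = det M · D 1.

open import Defs
open import Algebra.Bundles using (CommutativeRing)
open import Data.Bool.Base using (Bool; true; false; _∧_)
open import Data.Empty using (⊥-elim)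
open import Data.Fin.Base using (Fin; zero; suc; toℕ; punchIn; punchOut; opposite; remQuot)
open import Data.Fin.Properties
  using (_≟_; *↔×; opposite-involutive; opposite-prop; punchInᵢ≢i; punchIn-punchOut; punchIn-injective; toℕ<n)
open import Data.Nat.Base as ℕ using (ℕ; zero; suc; _≤_; z≤n; s≤s; _∸_; _⊔_; _≤ᵇ_; parity)
import Data.Nat.Properties as ℕ
open import Data.Parity.Base using (Parity; 0ℙ; 1ℙ)
open import Data.Product.Algebra using (×-comm)
open import Data.Product.Base using (∃-syntax; _×_; _,_; proj₁; proj₂)
open import Data.Sum.Base using (_⊎_; inj₁; inj₂)
open import Data.Vec.Functional using (Vector; _∷_; head; tail; insertAt; updateAt)
open import Data.Vec.Functional.Properties using (updateAt-updates; updateAt-minimal)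
open import Function.Base using (_∘_; const; flip)
open import Function.Bundles using (_↔_; Injection; Inverse; mk⇔)
open import Function.Properties.Inverse using (↔-trans; ↔⇒↣)
import Level
open import Relation.Binary.PropositionalEquality.Core as ≡ using (_≡_; _≢_)
open import Relation.Nullary.Decidable using (yes; no; does-⇔; _×-dec_)

-- No general product formula for determinants is used. Both V and the matrix behind K are block
-- diagonal, and left multiplication by a block diagonal matrix is alternating and multilinear in
-- the rows of each block, so uniqueness applied block by block gives the product of the block
-- determinants. The grouping into blocks may come from any bijection of the index set with pairs.
-- One lemma therefore serves V, whose blocks are contiguous, and K, whose blocks X_(i,i+1) gather
-- rows lying m apart, and the shuffle between the two orders never contributes a sign to be
-- computed. The circularity to avoid is that expansion along the first row does not show directly
-- that `det` alternates in its rows; the uniqueness principle is therefore proved from the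
-- expansion alone, before anything of that kind is known about `det`.

-- Consecutive indices and the deletion of an index

data Adjacent : ∀ {n} → Fin n → Fin n → Set where
  here  : ∀ {n} → Adjacent {suc (suc n)} zero (suc zero)
  there : ∀ {n} {i j : Fin n} → Adjacent i j → Adjacent (suc i) (suc j)

toℕ-adjacent : ∀ {n} {i j : Fin n} → Adjacent i j → toℕ j ≡ suc (toℕ i)
toℕ-adjacent here      = ≡.refl
toℕ-adjacent (there a) = ≡.cong suc (toℕ-adjacent a)

-- Deleting one or the other of two neighbours leaves lists that differ in a single place, where
-- each shows the neighbour deleted from the other. If the two columns are equal, the two minors
-- agree.
punchIn-adjacent : ∀ {n} {i j : Fin (suc n)} → Adjacent i j → ∀ q →
  punchIn i q ≡ punchIn j q ⊎ (punchIn i q ≡ j × punchIn j q ≡ i)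
punchIn-adjacent here zero = inj₂ (≡.refl , ≡.refl)
punchIn-adjacent here (suc q) = inj₁ ≡.refl
punchIn-adjacent (there a) zero = inj₁ ≡.refl
punchIn-adjacent {suc n} (there a) (suc q) with punchIn-adjacent a q
... | inj₁ e       = inj₁ (≡.cong suc e)
... | inj₂ (e , f) = inj₂ (≡.cong suc e , ≡.cong suc f)

-- No index lies between neighbours, so deleting a third one keeps them neighbours. This makes
-- induction on minors possible.
punchOut-adjacent : ∀ {n} {i j : Fin (suc n)} l → Adjacent i j → l ≢ i → l ≢ j →
  ∃[ i′ ] ∃[ j′ ] Adjacent {n} i′ j′ × punchIn l i′ ≡ i × punchIn l j′ ≡ j
punchOut-adjacent zero here l≢i l≢j = ⊥-elim (l≢i ≡.refl)
punchOut-adjacent zero (there a) l≢i l≢j = _ , _ , a , ≡.refl , ≡.refl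
punchOut-adjacent (suc zero) here l≢i l≢j = ⊥-elim (l≢j ≡.refl)
punchOut-adjacent {suc (suc n)} (suc (suc l)) here l≢i l≢j =
  zero , suc zero , here , ≡.refl , ≡.refl
punchOut-adjacent {suc n} (suc l) (there a) l≢i l≢j
  with punchOut-adjacent l a (l≢i ∘ ≡.cong suc) (l≢j ∘ ≡.cong suc)
... | i′ , j′ , a′ , e , f = suc i′ , suc j′ , there a′ , ≡.cong suc e , ≡.cong suc f

module _ {c ℓ} (R : CommutativeRing c ℓ) where
  open CommutativeRing R hiding (zero)
  open Matrices R
  open import Algebra.Properties.Semiring.Exp semiring using (_^_)
  open import Algebra.Properties.Semiring.Sum semiring
    using (sum; sum-cong-≋; ∑-distrib-+; *-distribˡ-sum; sum-replicate-zero)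
  open import Algebra.Properties.Ring ring
    using (-1*x≈-x; +-inverseˡ-unique; -0#≈0#)
  open import Algebra.Solver.Ring.NaturalCoefficients.Default commutativeSemiring
    using (solve; _:+_; _:*_; _:=_; con)
  open import Relation.Binary.Reasoning.Setoid setoid

  -- Finite sums and products, the identity matrix

  sum-zero : ∀ {n} (f : Vector Carrier n) → (∀ i → f i ≈ 0#) → sum f ≈ 0#
  sum-zero {n} f f≈0 = trans (sum-cong-≋ f≈0) (sum-replicate-zero n)

  sum-linear : ∀ {n} a (f g : Vector Carrier n) →
    sum (λ i → f i + a * g i) ≈ sum f + a * sum g
  sum-linear a f g = trans (∑-distrib-+ f _) (+-congˡ (sym (*-distribˡ-sum a g)))

  sum-adjacent : ∀ {n} {i j : Fin n} (f : Vector Carrier n) → Adjacent i j →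
    f i + f j ≈ 0# → (∀ l → l ≢ i → l ≢ j → f l ≈ 0#) → sum f ≈ 0#
  sum-adjacent f here fi+fj≈0 rest = begin
    f zero + (f (suc zero) + sum (tail (tail f))) ≈⟨ +-assoc _ _ _ ⟨
    f zero + f (suc zero) + sum (tail (tail f))   ≈⟨ +-cong fi+fj≈0 (sum-zero (tail (tail f)) λ l → rest (suc (suc l)) (λ ()) (λ ())) ⟩
    0# + 0#                                       ≈⟨ +-identityˡ 0# ⟩
    0#                                            ∎
  sum-adjacent f (there a) fi+fj≈0 rest = trans
    (+-cong (rest zero (λ ()) (λ ()))
            (sum-adjacent (tail f) a fi+fj≈0 λ l l≢i l≢j →
              rest (suc l) (λ { ≡.refl → l≢i ≡.refl }) (λ { ≡.refl → l≢j ≡.refl })))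
    (+-identityˡ 0#)

  product-cong : ∀ {n} {f g : Vector Carrier n} → (∀ i → f i ≈ g i) → product f ≈ product g
  product-cong {zero}  f≈g = refl
  product-cong {suc n} f≈g = *-cong (f≈g zero) (product-cong (f≈g ∘ suc))

  product-square : ∀ {n} (f : Vector Carrier n) → (∀ i → f i * f i ≈ 1#) → product f * product f ≈ 1#
  product-square {zero}  f f²≈1 = *-identityˡ 1#
  product-square {suc n} f f²≈1 = begin
    f zero * p * (f zero * p)   ≈⟨ solve 2 (λ a b → (a :* b) :* (a :* b) := (a :* a) :* (b :* b)) refl (f zero) p ⟩
    f zero * f zero * (p * p)   ≈⟨ *-cong (f²≈1 zero) (product-square (tail f) (f²≈1 ∘ suc)) ⟩
    1# * 1#                     ≈⟨ *-identityˡ 1# ⟩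
    1#                          ∎
    where p = product (tail f)

  1ᴹ : ∀ {n} → Matrix n
  1ᴹ zero    zero    = 1#
  1ᴹ zero    (suc j) = 0#
  1ᴹ (suc i) zero    = 0#
  1ᴹ (suc i) (suc j) = 1ᴹ i j

  1ᴹ-diagonal : ∀ {n} (i : Fin n) → 1ᴹ i i ≈ 1#
  1ᴹ-diagonal zero    = refl
  1ᴹ-diagonal (suc i) = 1ᴹ-diagonal i

  1ᴹ-off-diagonal : ∀ {n} {i j : Fin n} → i ≢ j → 1ᴹ i j ≈ 0#
  1ᴹ-off-diagonal {i = zero}  {zero}  i≢j = ⊥-elim (i≢j ≡.refl)
  1ᴹ-off-diagonal {i = zero}  {suc j} i≢j = refl
  1ᴹ-off-diagonal {i = suc i} {zero}  i≢j = refl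
  1ᴹ-off-diagonal {i = suc i} {suc j} i≢j = 1ᴹ-off-diagonal (i≢j ∘ ≡.cong suc)

  1ᴹ-sym : ∀ {n} (i j : Fin n) → 1ᴹ i j ≈ 1ᴹ j i
  1ᴹ-sym zero    zero    = refl
  1ᴹ-sym zero    (suc j) = refl
  1ᴹ-sym (suc i) zero    = refl
  1ᴹ-sym (suc i) (suc j) = 1ᴹ-sym i j

  sum-1ᴹ : ∀ {n} (f : Vector Carrier n) j → sum (λ i → f i * 1ᴹ i j) ≈ f j
  sum-1ᴹ f zero = begin
    f zero * 1# + sum (λ i → f (suc i) * 0#) ≈⟨ +-cong (*-identityʳ _) (sum-zero (λ i → f (suc i) * 0#) λ i → zeroʳ _) ⟩
    f zero + 0#                              ≈⟨ +-identityʳ _ ⟩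
    f zero                                   ∎
  sum-1ᴹ f (suc j) = begin
    f zero * 0# + sum (λ i → f (suc i) * 1ᴹ i j) ≈⟨ +-cong (zeroʳ _) (sum-1ᴹ (tail f) j) ⟩
    0# + f (suc j)                               ≈⟨ +-identityˡ _ ⟩
    f (suc j)                                    ∎

  -- Congruence, and alternating multilinear functions of the rows

  det-cong : ∀ {n} {M M′ : Matrix n} → (∀ i j → M i j ≈ M′ i j) → det M ≈ det M′
  det-cong {zero}  M≈M′ = refl
  det-cong {suc n} M≈M′ = sum-cong-≋ λ j →
    *-cong (*-congˡ {(- 1#) ^ toℕ j} (M≈M′ zero j)) (det-cong λ p q → M≈M′ (suc p) (punchIn j q))

  -- Linearity in one row is phrased by comparing whole matrices that agree elsewhere, so that it
  -- applies to matrices of any form, with no row update to compute and no function extensionality.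
  _≋_off_ : {I J : Set} → (I → J → Carrier) → (I → J → Carrier) → I → Set ℓ
  M ≋ M′ off i = ∀ k → k ≢ i → ∀ j → M k j ≈ M′ k j

  -- The relation _#_ tells which coincidences of rows force D to vanish: all of
  -- them (_≢_), those of consecutive rows (Adjacent) or those inside one block.
  record Alternating {I J : Set} (_#_ : I → I → Set) (D : (I → J → Carrier) → Carrier) :
         Set (c Level.⊔ ℓ) where
    field
      cong      : ∀ {M M′} → (∀ i j → M i j ≈ M′ i j) → D M ≈ D M′
      linear    : ∀ i a {M M′ M″} → M ≋ M′ off i → M ≋ M″ off i →
                  (∀ j → M i j ≈ M′ i j + a * M″ i j) → D M ≈ D M′ + a * D M″
      alternate : ∀ {i j M} → i # j → (∀ q → M i q ≈ M j q) → D M ≈ 0#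

  module _ {I J I′ J′ : Set} {_#_ : I → I → Set} {_#′_ : I′ → I′ → Set}
    {D : (I → J → Carrier) → Carrier} (alt : Alternating _#_ D)
    (φ : (I′ → J′ → Carrier) → (I → J → Carrier)) (f : I′ → I) where

    open Alternating alt

    -- If row `i` of the argument influences only row `f i` of its image, and does so linearly, the
    -- axioms carry over. Fixing a row, inserting a zero column, reversing the rows, gluing on a
    -- block and acting by blocks are all instances.
    pullback :
      (∀ {Z Z′} → (∀ i j → Z i j ≈ Z′ i j) → ∀ i j → φ Z i j ≈ φ Z′ i j) →
      (∀ i {Z Z′} → Z ≋ Z′ off i → φ Z ≋ φ Z′ off f i) →
      (∀ i a {Z Z′ Z″} → (∀ j → Z i j ≈ Z′ i j + a * Z″ i j) →
        ∀ j → φ Z (f i) j ≈ φ Z′ (f i) j + a * φ Z″ (f i) j) →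
      (∀ {i j} → i #′ j → f i # f j) →
      (∀ {i j Z} → i #′ j → (∀ q → Z i q ≈ Z j q) → ∀ q → φ Z (f i) q ≈ φ Z (f j) q) →
      Alternating _#′_ (D ∘ φ)
    pullback φ-cong φ-off φ-linear f-# φ-alternate = record
      { cong      = λ e → cong (φ-cong e)
      ; linear    = λ i a e e′ l → linear (f i) a (φ-off i e) (φ-off i e′) (φ-linear i a l)
      ; alternate = λ i#j e → alternate (f-# i#j) (φ-alternate i#j e)
      }

  ∷-cong : ∀ {n} {J : Set} {u v : J → Carrier} {S T : Fin n → J → Carrier} →
    (∀ j → u j ≈ v j) → (∀ i j → S i j ≈ T i j) → ∀ i j → (u ∷ S) i j ≈ (v ∷ T) i j
  ∷-cong u≈v S≈T zero    = u≈v
  ∷-cong u≈v S≈T (suc i) = S≈T i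

  head∷tail : ∀ {n} {J : Set} (M : Fin (suc n) → J → Carrier) → ∀ i j → M i j ≈ (head M ∷ tail M) i j
  head∷tail M zero    j = refl
  head∷tail M (suc i) j = refl

  ∷-off : ∀ {n} {J : Set} {u : J → Carrier} {S T : Fin n → J → Carrier} i →
    S ≋ T off i → (u ∷ S) ≋ (u ∷ T) off suc i
  ∷-off i S≋T zero    k≢i j = refl
  ∷-off i S≋T (suc k) k≢i j = S≋T k (k≢i ∘ ≡.cong suc) j

  ∷-off-zero : ∀ {n} {J : Set} {u v : J → Carrier} {T : Fin n → J → Carrier} → (u ∷ T) ≋ (v ∷ T) off zero
  ∷-off-zero zero    k≢0 j = ⊥-elim (k≢0 ≡.refl)
  ∷-off-zero (suc k) k≢0 j = refl

  module _ {n : ℕ} {J : Set} {_#_ : Fin (suc n) → Fin (suc n) → Set}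
    {D : (Fin (suc n) → J → Carrier) → Carrier} (alt : Alternating _#_ D) where

    open Alternating alt

    fix-head : {_#′_ : Fin n → Fin n → Set} → (∀ {i j} → i #′ j → suc i # suc j) →
      ∀ u → Alternating _#′_ (λ T → D (u ∷ T))
    fix-head suc-# u = pullback alt (u ∷_) suc (∷-cong λ _ → refl) (λ i → ∷-off i)
      (λ i a l → l) suc-# (λ _ e → e)

    -- Writing the zero row as 0 + (-1) * 0 turns the linearity axiom into d = d - d.
    zero-head : ∀ T → D ((λ _ → 0#) ∷ T) ≈ 0#
    zero-head T = begin
      d               ≈⟨ linear zero (- 1#) ∷-off-zero ∷-off-zero (λ j → sym (trans (+-congˡ (zeroʳ _)) (+-identityˡ 0#))) ⟩
      d + - 1# * d    ≈⟨ +-congˡ (-1*x≈-x d) ⟩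
      d - d           ≈⟨ -‿inverseʳ d ⟩
      0#              ∎
      where d = D ((λ _ → 0#) ∷ T)

    linear-head : ∀ {k} (a : Vector Carrier k) (w : Fin k → J → Carrier) T →
      D ((λ j → sum λ l → a l * w l j) ∷ T) ≈ sum λ l → a l * D (w l ∷ T)
    linear-head {zero}  a w T = zero-head T
    linear-head {suc k} a w T = begin
      D ((λ j → sum λ l → a l * w l j) ∷ T)
        ≈⟨ linear zero (a zero) ∷-off-zero ∷-off-zero (λ j → +-comm _ _) ⟩
      D ((λ j → sum λ l → a (suc l) * w (suc l) j) ∷ T) + a zero * D (w zero ∷ T)
        ≈⟨ +-comm _ _ ⟩
      a zero * D (w zero ∷ T) + D ((λ j → sum λ l → a (suc l) * w (suc l) j) ∷ T)
        ≈⟨ +-congˡ (linear-head (tail a) (tail w) T) ⟩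
      sum (λ l → a l * D (w l ∷ T))
        ∎

  module _ {n : ℕ} {J : Set} {_#_ : Fin (suc (suc n)) → Fin (suc (suc n)) → Set}
    {D : (Fin (suc (suc n)) → J → Carrier) → Carrier} (alt : Alternating _#_ D) (0#1 : zero # suc zero) where

    open Alternating alt

    swap-rows : ∀ u v T → D (u ∷ v ∷ T) ≈ - D (v ∷ u ∷ T)
    swap-rows u v T = +-inverseˡ-unique _ _ (begin
      f u v + f v u
        -- Polarisation: the two zeros stand for `f v v` and `f u u`, and the padding with units
        -- matches the expansion of `f w w` for w = v + u.
        ≈⟨ solve 2 (λ x y → x :+ y := (con 0 :+ con 1 :* y) :+ con 1 :* (x :+ con 1 :* con 0)) refl (f u v) (f v u) ⟩
      _
        ≈⟨ +-cong (+-congʳ (f-diagonal v)) (*-congˡ (+-congˡ (*-congˡ (f-diagonal u)))) ⟨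
      (f v v + 1# * f v u) + 1# * (f u v + 1# * f u u)
        ≈⟨ +-cong (additiveʳ v) (*-congˡ (additiveʳ u)) ⟨
      f v w + 1# * f u w
        ≈⟨ linear zero 1# ∷-off-zero ∷-off-zero (λ _ → refl) ⟨
      f w w
        ≈⟨ f-diagonal w ⟩
      0# ∎)
      where
      f : (J → Carrier) → (J → Carrier) → Carrier
      f u v = D (u ∷ v ∷ T)
      w : J → Carrier
      w j = v j + 1# * u j
      f-diagonal : ∀ u → f u u ≈ 0#
      f-diagonal u = alternate 0#1 (λ _ → refl)
      additiveʳ : ∀ t → f t w ≈ f t v + 1# * f t u
      additiveʳ t = linear (suc zero) 1# (∷-off zero ∷-off-zero) (∷-off zero ∷-off-zero) (λ _ → refl)

  mutual
    coincide : ∀ {n} {J : Set} {D : (Fin n → J → Carrier) → Carrier} → Alternating Adjacent D →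
      ∀ i j {M} → i ≢ j → (∀ q → M i q ≈ M j q) → D M ≈ 0#
    coincide alt zero zero i≢j e = ⊥-elim (i≢j ≡.refl)
    coincide alt zero (suc j) i≢j e = coincide-head alt j e
    coincide alt (suc i) zero i≢j e = coincide-head alt i (λ q → sym (e q))
    coincide alt (suc i) (suc j) {M} i≢j e = trans (Alternating.cong alt (head∷tail M))
      (coincide (fix-head alt there (head M)) i j (i≢j ∘ ≡.cong suc) e)

    -- Swapping the first two rows costs a sign and moves row zero one place towards its copy.
    -- Freezing the new first row then leaves a shorter instance, until the copies are neighbours.
    coincide-head : ∀ {n} {J : Set} {D : (Fin (suc n) → J → Carrier) → Carrier} → Alternating Adjacent D →
      ∀ j {M} → (∀ q → M zero q ≈ M (suc j) q) → D M ≈ 0#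
    coincide-head alt zero e = Alternating.alternate alt here e
    coincide-head {suc n} {D = D} alt (suc j) {M} e = begin
      D M                             ≈⟨ cong (λ { zero j → refl ; (suc zero) j → refl ; (suc (suc i)) j → refl }) ⟩
      D (M zero ∷ M (suc zero) ∷ T)   ≈⟨ swap-rows alt here _ _ _ ⟩
      - D (M (suc zero) ∷ M zero ∷ T) ≈⟨ -‿cong (coincide-head (fix-head alt there (M (suc zero))) j e) ⟩
      - 0#                            ≈⟨ -0#≈0# ⟩
      0#                              ∎
      where
      open Alternating alt
      T = λ i → M (suc (suc i))

  adjacent⇒alternating : ∀ {n} {J : Set} {D : (Fin n → J → Carrier) → Carrier} →
    Alternating Adjacent D → Alternating _≢_ D
  adjacent⇒alternating alt = record
    { cong      = Alternating.cong alt
    ; linear    = Alternating.linear alt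
    ; alternate = λ {i} {j} → coincide alt i j
    }

  -- Row `j` reaches the top by `toℕ j` swaps of neighbours; this is where the cofactor sign comes
  -- from.
  rotate : ∀ {n} {J : Set} {D : (Fin (suc n) → J → Carrier) → Carrier} → Alternating _≢_ D →
    ∀ W j → D (W j ∷ W ∘ punchIn j) ≈ (- 1#) ^ toℕ j * D W
  rotate alt W zero = trans (cong λ { zero j → refl ; (suc i) j → refl }) (sym (*-identityˡ _))
    where open Alternating alt
  rotate {suc n} {D = D} alt W (suc j) = begin
    D (W (suc j) ∷ W ∘ punchIn (suc j))
      ≈⟨ cong (λ { zero j → refl ; (suc zero) j → refl ; (suc (suc i)) j → refl }) ⟩
    D (W (suc j) ∷ W zero ∷ tail W ∘ punchIn j)
      ≈⟨ swap-rows alt (λ ()) _ _ _ ⟩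
    - D (W zero ∷ W (suc j) ∷ tail W ∘ punchIn j)
      ≈⟨ -‿cong (rotate (fix-head alt (λ { i≢j ≡.refl → i≢j ≡.refl }) (W zero)) (tail W) j) ⟩
    - ((- 1#) ^ toℕ j * D (W zero ∷ tail W))
      ≈⟨ -‿cong (*-congˡ (cong (head∷tail W))) ⟨
    - ((- 1#) ^ toℕ j * D W)
      ≈⟨ -1*x≈-x _ ⟨
    - 1# * ((- 1#) ^ toℕ j * D W)
      ≈⟨ *-assoc _ _ _ ⟨
    (- 1#) ^ suc (toℕ j) * D W
      ∎
    where open Alternating alt

  -- In the application `e` is a frozen row outside `T`, so adding multiples of it to a row of `T`
  -- changes nothing. With `E` abstract, the induction can freeze each row once it is cleared.
  clear : ∀ {n} {J : Set} (E : (Fin n → J → Carrier) → Carrier) (e : J → Carrier) →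
    (∀ {T T′} → (∀ i j → T i j ≈ T′ i j) → E T ≈ E T′) →
    (∀ k a {T T′} → T ≋ T′ off k → (∀ j → T k j ≈ T′ k j + a * e j) → E T ≈ E T′) →
    ∀ (a : Vector Carrier n) {T T′} → (∀ k j → T k j ≈ T′ k j + a k * e j) → E T ≈ E T′
  clear {zero}  E e E-cong E-add a T≈ = E-cong λ ()
  clear {suc n} E e E-cong E-add a {T} {T′} T≈ = begin
    E T                  ≈⟨ E-add zero (a zero) (λ { zero k≢0 j → ⊥-elim (k≢0 ≡.refl) ; (suc k) k≢0 j → refl }) (T≈ zero) ⟩
    E (head T′ ∷ tail T) ≈⟨ clear (λ S → E (head T′ ∷ S)) e (λ S≈ → E-cong (∷-cong (λ _ → refl) S≈))
                              (λ k b S≋ → E-add (suc k) b (∷-off k S≋)) (tail a) (λ k → T≈ (suc k)) ⟩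
    E (head T′ ∷ tail T′) ≈⟨ E-cong (head∷tail T′) ⟨
    E T′                  ∎

  -- Zero columns and the uniqueness of the determinant

  insert-zero : ∀ {n} (j : Fin (suc n)) q → insertAt (λ _ → 0#) j 0# q ≈ 0#
  insert-zero         zero    zero    = refl
  insert-zero         zero    (suc q) = refl
  insert-zero {suc n} (suc j) zero    = refl
  insert-zero {suc n} (suc j) (suc q) = insert-zero j q

  insert-cong : ∀ {n} (j : Fin (suc n)) {v w : Vector Carrier n} → (∀ q → v q ≈ w q) →
    ∀ q → insertAt v j 0# q ≈ insertAt w j 0# q
  insert-cong         zero    v≈w zero    = refl
  insert-cong         zero    v≈w (suc q) = v≈w q
  insert-cong {suc n} (suc j) v≈w zero    = v≈w zero
  insert-cong {suc n} (suc j) v≈w (suc q) = insert-cong j (v≈w ∘ suc) q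

  insert-linear : ∀ {n} (j : Fin (suc n)) a {u v w : Vector Carrier n} → (∀ q → u q ≈ v q + a * w q) →
    ∀ q → insertAt u j 0# q ≈ insertAt v j 0# q + a * insertAt w j 0# q
  insert-linear         zero    a u≈ zero    = sym (trans (+-congˡ (zeroʳ a)) (+-identityˡ 0#))
  insert-linear         zero    a u≈ (suc q) = u≈ q
  insert-linear {suc n} (suc j) a u≈ zero    = u≈ zero
  insert-linear {suc n} (suc j) a u≈ (suc q) = insert-linear j a (u≈ ∘ suc) q

  -- This supplies the multiples of the unit row that `clear` removes: what remains of `v` has a
  -- zero in place `j`.
  insert-punchIn : ∀ {n} (j : Fin (suc n)) (v : Vector Carrier (suc n)) q →
    v q ≈ insertAt (v ∘ punchIn j) j 0# q + v j * 1ᴹ j q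
  insert-punchIn zero v zero = sym (trans (+-identityˡ _) (*-identityʳ _))
  insert-punchIn zero v (suc q) = sym (trans (+-congˡ (zeroʳ _)) (+-identityʳ _))
  insert-punchIn {suc n} (suc j) v zero = sym (trans (+-congˡ (zeroʳ _)) (+-identityʳ _))
  insert-punchIn {suc n} (suc j) v (suc q) = insert-punchIn j (tail v) q

  1ᴹ-punchIn : ∀ {n} (j : Fin (suc n)) k q → 1ᴹ (punchIn j k) q ≈ insertAt (1ᴹ k) j 0# q
  1ᴹ-punchIn zero    k       zero    = refl
  1ᴹ-punchIn zero    k       (suc q) = refl
  1ᴹ-punchIn (suc j) zero    zero    = refl
  1ᴹ-punchIn (suc j) zero    (suc q) = sym (insert-zero j q)
  1ᴹ-punchIn (suc j) (suc k) zero    = refl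
  1ᴹ-punchIn (suc j) (suc k) (suc q) = 1ᴹ-punchIn j k q

  -- Expanding the first row in unit rows reproduces the cofactor expansion. Under the unit row
  -- `1ᴹ j`, column `j` can be cleared, so that only the minor matters and induction applies; the
  -- constant left over is `D` at the identity with row `j` brought to the top, which `rotate`
  -- evaluates.
  det-unique : ∀ {n} {D : Matrix n → Carrier} → Alternating _≢_ D → ∀ M → D M ≈ det M * D 1ᴹ
  det-unique {zero} alt M = trans (Alternating.cong alt λ ()) (sym (*-identityˡ _))
  det-unique {suc n} {D} alt M = begin
    D M
      ≈⟨ cong (λ { zero q → sym (sum-1ᴹ (M zero) q) ; (suc i) q → refl }) ⟩
    D ((λ q → sum λ j → M zero j * 1ᴹ j q) ∷ tail M)
      ≈⟨ linear-head alt (M zero) 1ᴹ (tail M) ⟩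
    sum (λ j → M zero j * D (1ᴹ j ∷ tail M))
      ≈⟨ sum-cong-≋ term ⟩
    sum (λ j → D 1ᴹ * ((- 1#) ^ toℕ j * M zero j * det (minor j)))
      ≈⟨ *-distribˡ-sum (D 1ᴹ) (λ j → (- 1#) ^ toℕ j * M zero j * det (minor j)) ⟨
    D 1ᴹ * det M
      ≈⟨ *-comm _ _ ⟩
    det M * D 1ᴹ
      ∎
    where
    open Alternating alt
    minor : Fin (suc n) → Matrix n
    minor j p q = M (suc p) (punchIn j q)
    insert : Fin (suc n) → Matrix n → Fin n → Vector Carrier (suc n)
    insert j S p = insertAt (S p) j 0#
    tail-alt : ∀ j → Alternating _≢_ (λ T → D (1ᴹ j ∷ T))
    tail-alt j = fix-head alt (λ { i≢j ≡.refl → i≢j ≡.refl }) (1ᴹ j)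
    minor-alt : ∀ j → Alternating _≢_ (λ S → D (1ᴹ j ∷ insert j S))
    minor-alt j = pullback (tail-alt j) (insert j) (λ i → i)
      (λ S≈ i → insert-cong j (S≈ i)) (λ i S≋ k k≢i → insert-cong j (S≋ k k≢i))
      (λ i a → insert-linear j a) (λ i≢j → i≢j) (λ _ → insert-cong j)
    add-1ᴹ : ∀ j k a {T T′} → T ≋ T′ off k → (∀ q → T k q ≈ T′ k q + a * 1ᴹ j q) →
      D (1ᴹ j ∷ T) ≈ D (1ᴹ j ∷ T′)
    add-1ᴹ j k a {T} {T′} T≋T′ Tk≈ = begin
      D (1ᴹ j ∷ T)
        ≈⟨ linear (suc k) a (∷-off k T≋T′)
             (∷-off k λ l l≢k q → trans (T≋T′ l l≢k q) (reflexive (≡.sym (≡.cong-app (updateAt-minimal l k T′ l≢k) q))))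
             (λ q → trans (Tk≈ q) (+-congˡ (*-congˡ (sym (U-k q))))) ⟩
      D (1ᴹ j ∷ T′) + a * D (1ᴹ j ∷ U)
        ≈⟨ +-congˡ (*-congˡ (alternate {zero} {suc k} (λ ()) (λ q → sym (U-k q)))) ⟩
      D (1ᴹ j ∷ T′) + a * 0#
        ≈⟨ trans (+-congˡ (zeroʳ a)) (+-identityʳ _) ⟩
      D (1ᴹ j ∷ T′)
        ∎
      where
      -- The correction term: its row `k` repeats the unit row above it, so `D` vanishes there.
      U = updateAt T′ k (const (1ᴹ j))
      U-k : ∀ q → U k q ≈ 1ᴹ j q
      U-k q = reflexive (≡.cong-app (updateAt-updates k T′) q)
    term : ∀ j → M zero j * D (1ᴹ j ∷ tail M) ≈ D 1ᴹ * ((- 1#) ^ toℕ j * M zero j * det (minor j))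
    term j = begin
      M zero j * D (1ᴹ j ∷ tail M)
        ≈⟨ *-congˡ (clear (λ T → D (1ᴹ j ∷ T)) (1ᴹ j) (Alternating.cong (tail-alt j)) (add-1ᴹ j)
             (λ p → M (suc p) j) (λ p → insert-punchIn j (M (suc p)))) ⟩
      M zero j * D (1ᴹ j ∷ insert j (minor j))
        ≈⟨ *-congˡ (det-unique (minor-alt j) (minor j)) ⟩
      M zero j * (det (minor j) * D (1ᴹ j ∷ insert j 1ᴹ))
        ≈⟨ *-congˡ (*-congˡ (cong (∷-cong (λ _ → refl) (1ᴹ-punchIn j)))) ⟨
      M zero j * (det (minor j) * D (1ᴹ j ∷ 1ᴹ ∘ punchIn j))
        ≈⟨ *-congˡ (*-congˡ (rotate alt 1ᴹ j)) ⟩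
      M zero j * (det (minor j) * ((- 1#) ^ toℕ j * D 1ᴹ))
        ≈⟨ solve 4 (λ m d s e → m :* (d :* (s :* e)) := e :* (s :* m :* d)) refl
             (M zero j) (det (minor j)) ((- 1#) ^ toℕ j) (D 1ᴹ) ⟩
      D 1ᴹ * ((- 1#) ^ toℕ j * M zero j * det (minor j))
        ∎

  -- The determinant as an alternating function of columns, then of rows

  det-column-linear : ∀ {n} c a {M M′ M″ : Matrix n} →
    flip M ≋ flip M′ off c → flip M ≋ flip M″ off c →
    (∀ p → M p c ≈ M′ p c + a * M″ p c) → det M ≈ det M′ + a * det M″
  det-column-linear {suc n} c a {M} {M′} {M″} M≋M′ M≋M″ Mc≈ =
    trans (sum-cong-≋ term) (sum-linear a (cofactor M′) (cofactor M″))
    where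
    minor : Matrix (suc n) → Fin (suc n) → Matrix n
    minor M j p q = M (suc p) (punchIn j q)
    cofactor : Matrix (suc n) → Fin (suc n) → Carrier
    cofactor M j = (- 1#) ^ toℕ j * M zero j * det (minor M j)
    term : ∀ j → cofactor M j ≈ cofactor M′ j + a * cofactor M″ j
    term j with j ≟ c
    -- The entry carries the linearity, and the minor omits column `c`.
    ... | yes ≡.refl = begin
      σ * M zero j * det (minor M j)
        ≈⟨ *-congʳ (*-congˡ (Mc≈ zero)) ⟩
      σ * (M′ zero j + a * M″ zero j) * det (minor M j)
        ≈⟨ solve 5 (λ s x a y d → s :* (x :+ a :* y) :* d := s :* x :* d :+ a :* (s :* y :* d)) refl
             σ (M′ zero j) a (M″ zero j) (det (minor M j)) ⟩
      σ * M′ zero j * det (minor M j) + a * (σ * M″ zero j * det (minor M j))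
        ≈⟨ +-cong (*-congˡ (det-cong λ p q → M≋M′ _ (punchInᵢ≢i j q) (suc p)))
                  (*-congˡ (*-congˡ (det-cong λ p q → M≋M″ _ (punchInᵢ≢i j q) (suc p)))) ⟩
      cofactor M′ j + a * cofactor M″ j
        ∎
      where σ = (- 1#) ^ toℕ j
    -- The entry lies outside column `c`, and the minor is linear by induction in the place `c′`
    -- that this column occupies there.
    ... | no j≢c = begin
      σ * M zero j * det (minor M j)
        ≈⟨ *-congˡ (det-column-linear c′ a (λ k k≢c′ p → M≋M′ _ (off k k≢c′) (suc p))
             (λ k k≢c′ p → M≋M″ _ (off k k≢c′) (suc p))
             λ p → ≡.subst (λ c → M (suc p) c ≈ M′ (suc p) c + a * M″ (suc p) c)
                     (≡.sym (punchIn-punchOut j≢c)) (Mc≈ (suc p))) ⟩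
      σ * M zero j * (det (minor M′ j) + a * det (minor M″ j))
        ≈⟨ solve 5 (λ s m d a e → s :* m :* (d :+ a :* e) := s :* m :* d :+ a :* (s :* m :* e)) refl
             σ (M zero j) (det (minor M′ j)) a (det (minor M″ j)) ⟩
      σ * M zero j * det (minor M′ j) + a * (σ * M zero j * det (minor M″ j))
        ≈⟨ +-cong (*-congʳ (*-congˡ (M≋M′ j j≢c zero))) (*-congˡ (*-congʳ (*-congˡ (M≋M″ j j≢c zero)))) ⟩
      cofactor M′ j + a * cofactor M″ j
        ∎
      where
      σ = (- 1#) ^ toℕ j
      c′ = punchOut j≢c
      off : ∀ k → k ≢ c′ → punchIn j k ≢ c
      off k k≢c′ e = k≢c′ (punchIn-injective j k c′ (≡.trans e (≡.sym (punchIn-punchOut j≢c))))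

  -- The cofactors at `i` and `j` have equal minors and opposite signs, and every other minor still
  -- contains the two equal neighbours. For distant columns the two minors would differ by a
  -- permutation, hence the restriction to neighbours.
  det-adjacent-columns : ∀ {n} {i j : Fin n} {M : Matrix n} → Adjacent i j →
    (∀ p → M p i ≈ M p j) → det M ≈ 0#
  det-adjacent-columns {suc n} {i} {j} {M} a Mi≈Mj = sum-adjacent cofactor a cancel others
    where
    minor : Fin (suc n) → Matrix n
    minor l p q = M (suc p) (punchIn l q)
    cofactor : Fin (suc n) → Carrier
    cofactor l = (- 1#) ^ toℕ l * M zero l * det (minor l)
    minors-equal : ∀ p q → minor j p q ≈ minor i p q
    minors-equal p q with punchIn-adjacent a q
    ... | inj₁ e       = reflexive (≡.cong (M (suc p)) (≡.sym e))
    ... | inj₂ (e , f) = begin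
      M (suc p) (punchIn j q) ≡⟨ ≡.cong (M (suc p)) f ⟩
      M (suc p) i             ≈⟨ Mi≈Mj (suc p) ⟩
      M (suc p) j             ≡⟨ ≡.cong (M (suc p)) e ⟨
      M (suc p) (punchIn i q) ∎
    cancel : cofactor i + cofactor j ≈ 0#
    cancel = begin
      cofactor i + (- 1#) ^ toℕ j * M zero j * det (minor j)
        ≈⟨ +-congˡ (*-cong (*-cong (reflexive (≡.cong ((- 1#) ^_) (toℕ-adjacent a))) (sym (Mi≈Mj zero)))
                           (det-cong minors-equal)) ⟩
      cofactor i + - 1# * (- 1#) ^ toℕ i * M zero i * det (minor i)
        ≈⟨ +-congˡ (trans (*-congʳ (*-assoc _ _ _)) (*-assoc _ _ _)) ⟩
      cofactor i + - 1# * cofactor i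
        ≈⟨ +-congˡ (-1*x≈-x _) ⟩
      cofactor i - cofactor i
        ≈⟨ -‿inverseʳ _ ⟩
      0#
        ∎
    others : ∀ l → l ≢ i → l ≢ j → cofactor l ≈ 0#
    others l l≢i l≢j with punchOut-adjacent l a l≢i l≢j
    ... | i′ , j′ , a′ , ≡.refl , ≡.refl =
      trans (*-congˡ (det-adjacent-columns a′ (Mi≈Mj ∘ suc))) (zeroʳ _)

  -- Expansion along the first row makes the alternation in the columns the
  -- accessible one; uniqueness then gives det Mᵀ = det M, hence that in the rows.
  det-flip-alternating : ∀ {n} → Alternating {Fin n} _≢_ (λ M → det (flip M))
  det-flip-alternating = adjacent⇒alternating record
    { cong      = λ e → det-cong (flip e)
    ; linear    = λ i a {M} {M′} {M″} → det-column-linear i a {flip M} {flip M′} {flip M″}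
    ; alternate = λ {i} {j} {M} → det-adjacent-columns {M = flip M}
    }

  det-lower : ∀ {n} (M : Matrix (suc n)) → (∀ j → M zero (suc j) ≈ 0#) →
    det M ≈ M zero zero * det (λ p q → M (suc p) (suc q))
  det-lower {n} M M₀≈0 = begin
    1# * M zero zero * d + sum (tail cofactor)
      ≈⟨ +-cong (*-congʳ (*-identityˡ _)) (sum-zero (tail cofactor) λ j →
           trans (*-congʳ (trans (*-congˡ (M₀≈0 j)) (zeroʳ _))) (zeroˡ _)) ⟩
    M zero zero * d + 0#
      ≈⟨ +-identityʳ _ ⟩
    M zero zero * d
      ∎
    where
    d = det (λ p q → M (suc p) (suc q))
    cofactor : Fin (suc n) → Carrier
    cofactor j = (- 1#) ^ toℕ j * M zero j * det (λ p q → M (suc p) (punchIn j q))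

  det-1ᴹ : ∀ n → det (1ᴹ {n}) ≈ 1#
  det-1ᴹ zero    = refl
  det-1ᴹ (suc n) = trans (det-lower {n} 1ᴹ (λ j → refl)) (trans (*-identityˡ _) (det-1ᴹ n))

  det-transpose : ∀ {n} (M : Matrix n) → det (flip M) ≈ det M
  det-transpose {n} M = begin
    det (flip M)               ≈⟨ det-unique det-flip-alternating M ⟩
    det M * det (flip (1ᴹ {n})) ≈⟨ *-congˡ (trans (det-cong {n} λ i j → 1ᴹ-sym j i) (det-1ᴹ n)) ⟩
    det M * 1#                 ≈⟨ *-identityʳ _ ⟩
    det M                      ∎

  det-alternating : ∀ {n} → Alternating {Fin n} _≢_ det
  det-alternating = record
    { cong      = det-cong
    ; linear    = λ i a {M} {M′} {M″} e e′ l → trans (sym (det-transpose M)) (trans (linear i a e e′ l)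
                    (+-cong (det-transpose M′) (*-congˡ (det-transpose M″))))
    ; alternate = λ {i} {j} {M} i≢j e → trans (sym (det-transpose M)) (alternate i≢j e)
    }
    where open Alternating det-flip-alternating

  -- The sign of the reversal is left as det (1ᴹ ∘ opposite): reversing twice
  -- shows that its square is 1.
  det-opposite : ∀ {n} (M : Matrix n) → det (M ∘ opposite) ≈ det M * det (1ᴹ {n} ∘ opposite)
  det-opposite = det-unique (pullback det-alternating (_∘ opposite) opposite
    (λ e i → e (opposite i))
    (λ i e k k≢ → e (opposite k) λ { ≡.refl → k≢ (≡.sym (opposite-involutive k)) })
    (λ i a {Z} {Z′} {Z″} e → ≡.subst (λ k → ∀ j → Z k j ≈ Z′ k j + a * Z″ k j) (≡.sym (opposite-involutive i)) e)
    (λ {i} {j} i≢j e → i≢j (≡.trans (≡.sym (opposite-involutive i)) (≡.trans (≡.cong opposite e) (opposite-involutive j))))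
    (λ {i} {j} {Z} _ e q → ≡.subst₂ (λ k l → Z k q ≈ Z l q) (≡.sym (opposite-involutive i)) (≡.sym (opposite-involutive j)) (e q)))

  det-opposite-square : ∀ {n} (M : Matrix n) →
    det (M ∘ opposite) * det (M ∘ opposite) ≈ det M * det M
  det-opposite-square {n} M = begin
    det (M ∘ opposite) * det (M ∘ opposite)
      ≈⟨ *-cong (det-opposite M) (det-opposite M) ⟩
    det M * ε * (det M * ε)
      ≈⟨ solve 2 (λ d e → d :* e :* (d :* e) := d :* d :* (e :* e)) refl (det M) ε ⟩
    det M * det M * (ε * ε)
      -- `det-opposite` at the reversed identity itself, read from right to left.
      ≈⟨ *-congˡ (det-opposite (1ᴹ {n} ∘ opposite)) ⟨
    det M * det M * det (1ᴹ {n} ∘ opposite ∘ opposite)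
      ≈⟨ *-congˡ (trans (det-cong {n} λ i j → reflexive (≡.cong (λ k → 1ᴹ k j) (opposite-involutive i))) (det-1ᴹ n)) ⟩
    det M * det M * 1#
      ≈⟨ *-identityʳ _ ⟩
    det M * det M
      ∎
    where ε = det (1ᴹ {n} ∘ opposite)

  -- Left multiplication by block diagonal matrices

  SameBlock : ∀ {a b} → Fin a × Fin b → Fin a × Fin b → Set
  SameBlock (c , p) (d , q) = c ≡ d × p ≢ q

  glue : ∀ {a b} {J : Set} → (Fin b → J → Carrier) → (Fin a × Fin b → J → Carrier) →
    Fin (suc a) × Fin b → J → Carrier
  glue Z Y (zero  , p) = Z p
  glue Z Y (suc c , p) = Y (c , p)

  glue-cong : ∀ {a b} {J : Set} {Z Z′ : Fin b → J → Carrier} {Y Y′ : Fin a × Fin b → J → Carrier} →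
    (∀ p j → Z p j ≈ Z′ p j) → (∀ i j → Y i j ≈ Y′ i j) → ∀ i j → glue Z Y i j ≈ glue Z′ Y′ i j
  glue-cong Z≈ Y≈ (zero  , p) = Z≈ p
  glue-cong Z≈ Y≈ (suc c , p) = Y≈ (c , p)

  -- Uniqueness is applied to the first block with the others frozen; that block becomes the
  -- identity and the rest follow by induction. Only coincidences inside a block count: equal
  -- coefficient rows in different blocks will combine different rows of a matrix and force nothing
  -- to vanish.
  blocks-unique : ∀ {a b} {Ψ : (Fin a × Fin b → Fin b → Carrier) → Carrier} → Alternating SameBlock Ψ →
    ∀ Y → Ψ Y ≈ product (λ c → det (λ p → Y (c , p))) * Ψ (λ (c , p) → 1ᴹ p)
  blocks-unique {zero} alt Y = trans (Alternating.cong alt λ ()) (sym (*-identityˡ _))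
  blocks-unique {suc a} {b} {Ψ} alt Y = begin
    Ψ Y
      ≈⟨ cong (λ { (zero , p) j → refl ; (suc c , p) j → refl }) ⟩
    Ψ (glue Y₀ Y₊)
      ≈⟨ det-unique first Y₀ ⟩
    det Y₀ * Ψ (glue 1ᴹ Y₊)
      ≈⟨ *-congˡ (blocks-unique rest Y₊) ⟩
    det Y₀ * (product (λ c → det (λ p → Y₊ (c , p))) * Ψ (glue 1ᴹ (λ (c , p) → 1ᴹ p)))
      ≈⟨ *-assoc _ _ _ ⟨
    product (λ c → det (λ p → Y (c , p))) * Ψ (glue 1ᴹ (λ (c , p) → 1ᴹ p))
      ≈⟨ *-congˡ (cong (λ { (zero , p) j → refl ; (suc c , p) j → refl })) ⟩
    product (λ c → det (λ p → Y (c , p))) * Ψ (λ (c , p) → 1ᴹ p)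
      ∎
    where
    open Alternating alt
    Y₀ : Matrix b
    Y₀ p = Y (zero , p)
    Y₊ : Fin a × Fin b → Fin b → Carrier
    Y₊ (c , p) = Y (suc c , p)
    first : Alternating _≢_ (λ Z → Ψ (glue Z Y₊))
    first = pullback alt (λ Z → glue Z Y₊) (zero ,_)
      (λ e → glue-cong e (λ _ _ → refl))
      (λ { p e (zero , q) q≢p → e q (q≢p ∘ ≡.cong (zero ,_)) ; p e (suc c , q) _ j → refl })
      (λ i a e → e) (λ p≢q → ≡.refl , p≢q) (λ _ e → e)
    rest : Alternating SameBlock (λ Z → Ψ (glue 1ᴹ Z))
    rest = pullback alt (glue 1ᴹ) (λ (c , p) → suc c , p)
      (λ e → glue-cong (λ _ _ → refl) e)
      (λ { i e (zero , q) _ j → refl ; i e (suc d , q) k≢i → e (d , q) λ { ≡.refl → k≢i ≡.refl } })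
      (λ i a e → e) (λ { (≡.refl , p≢q) → ≡.refl , p≢q }) (λ _ e → e)

  module _ {n a b} (e : Fin n ↔ (Fin a × Fin b)) where

    open Inverse e using (to; from; strictlyInverseˡ; strictlyInverseʳ)

    -- For fixed `M` the left side is alternating in the rows of each `Y c`, and identity blocks
    -- give back `M`. Since `e` is arbitrary, the rows of a block may be scattered over the matrix.
    det-block-rows : (Y : Fin a → Matrix b) (M : Fin a × Fin b → Fin n → Carrier) →
      det (λ i j → let (c , p) = to i in sum λ k → Y c p k * M (c , k) j) ≈
      product (λ c → det (Y c)) * det (λ i → M (to i))
    det-block-rows Y M = begin
      det (act (λ (c , p) → Y c p))
        ≈⟨ blocks-unique act-alternating (λ (c , p) → Y c p) ⟩
      product (λ c → det (Y c)) * det (act (λ (c , p) → 1ᴹ p))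
        ≈⟨ *-congˡ (det-cong λ i j → let (c , p) = to i in
             trans (sum-cong-≋ λ k → trans (*-comm (1ᴹ p k) _) (*-congˡ (1ᴹ-sym p k))) (sum-1ᴹ (λ k → M (c , k) j) p)) ⟩
      product (λ c → det (Y c)) * det (λ i → M (to i))
        ∎
      where
      row : (Fin b → Carrier) → Fin a × Fin b → Fin n → Carrier
      row y (c , p) j = sum λ k → y k * M (c , k) j
      act : (Fin a × Fin b → Fin b → Carrier) → Matrix n
      act Y i = row (Y (to i)) (to i)
      row-cong : ∀ {y z} i → (∀ k → y k ≈ z k) → ∀ j → row y i j ≈ row z i j
      row-cong i y≈z j = sum-cong-≋ λ k → *-congʳ (y≈z k)
      act-alternating : Alternating SameBlock (det ∘ act)
      act-alternating = pullback det-alternating act from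
        (λ Y≈ i → row-cong (to i) (Y≈ (to i)))
        (λ i Y≋ k k≢ → row-cong (to k) (Y≋ (to k) λ { ≡.refl → k≢ (≡.sym (strictlyInverseʳ k)) }))
        (λ i s {Z} {Z′} {Z″} Y≈ j → ≡.subst (λ k → row (Z k) k j ≈ row (Z′ k) k j + s * row (Z″ k) k j)
          (≡.sym (strictlyInverseˡ i)) (row-linear i s Y≈ j))
        (λ { {c , p} {c , q} (≡.refl , p≢q) e → p≢q (≡.cong proj₂
          (≡.trans (≡.sym (strictlyInverseˡ _)) (≡.trans (≡.cong to e) (strictlyInverseˡ _)))) })
        (λ { {c , p} {c , q} {Z} (≡.refl , p≢q) e j →
          ≡.subst₂ (λ k l → row (Z k) k j ≈ row (Z l) l j) (≡.sym (strictlyInverseˡ _)) (≡.sym (strictlyInverseˡ _))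
            (row-cong (c , p) e j) })
        where
        row-linear : ∀ i s {y z w} → (∀ k → y k ≈ z k + s * w k) → ∀ j → row y i j ≈ row z i j + s * row w i j
        row-linear (c , p) s {y} {z} {w} y≈ j = trans
          (sum-cong-≋ λ k → trans (*-congʳ (y≈ k))
            (solve 4 (λ z s w m → (z :+ s :* w) :* m := z :* m :+ s :* (w :* m)) refl (z k) s (w k) (M (c , k) j)))
          (sum-linear s (λ k → z k * M (c , k) j) (λ k → w k * M (c , k) j))

  -- Thresholds, staircase matrices and telescoping

  indicator : Bool → Carrier
  indicator true  = 1#
  indicator false = 0#

  indicator-∧ : ∀ a b → indicator a * indicator b ≈ indicator (a ∧ b)
  indicator-∧ true  b = *-identityˡ _
  indicator-∧ false b = zeroˡ _

  ⊔-≤ᵇ : ∀ a b i → (a ≤ᵇ i) ∧ (b ≤ᵇ i) ≡ (a ⊔ b ≤ᵇ i)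
  ⊔-≤ᵇ a b i = does-⇔ (mk⇔ (λ (a≤i , b≤i) → ℕ.⊔-lub a≤i b≤i)
      (λ a⊔b≤i → ℕ.m⊔n≤o⇒m≤o a b a⊔b≤i , ℕ.m⊔n≤o⇒n≤o a b a⊔b≤i))
    ((a ℕ.≤? i) ×-dec (b ℕ.≤? i)) (a ⊔ b ℕ.≤? i)

  threshold : Parity → ∀ {m} → Fin m → ℕ
  threshold 0ℙ     p = pos p
  threshold 1ℙ {m} p = suc m ∸ pos p

  threshold>0 : ∀ π {m} (p : Fin m) → 1 ≤ threshold π p
  threshold>0 0ℙ p = s≤s z≤n
  threshold>0 1ℙ p = ℕ.m<n⇒0<n∸m (toℕ<n p)

  block-threshold : ∀ π ρ {m} (x : Vector Carrier m) p q → block π ρ x p q ≡ x ⟨ threshold π p ⊔ threshold ρ q ⟩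
  block-threshold 1ℙ 1ℙ {m} x p q = ≡.cong (x ⟨_⟩) (ℕ.∸-distribˡ-⊓-⊔ (suc m) (pos p) (pos q))
  block-threshold 1ℙ 0ℙ x p q = ≡.refl
  block-threshold 0ℙ 1ℙ x p q = ≡.refl
  block-threshold 0ℙ 0ℙ x p q = ≡.refl

  staircase : Parity → ∀ m → Matrix m
  staircase π m p i = indicator (threshold π p ≤ᵇ pos i)

  det-staircase-even : ∀ m → det (staircase 0ℙ m) ≈ 1#
  det-staircase-even m = trans (sym (det-transpose (staircase 0ℙ m))) (lower m)
    where
    lower : ∀ m → det (flip (staircase 0ℙ m)) ≈ 1#
    lower zero    = refl
    lower (suc m) = trans (det-lower (flip (staircase 0ℙ (suc m))) (λ j → refl)) (trans (*-identityˡ _) (lower m))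

  det-staircase-square : ∀ π m → det (staircase π m) * det (staircase π m) ≈ 1#
  det-staircase-square 0ℙ m = trans (*-cong (det-staircase-even m) (det-staircase-even m)) (*-identityˡ 1#)
  det-staircase-square 1ℙ m = begin
    det (staircase 1ℙ m) * det (staircase 1ℙ m)                         ≈⟨ *-cong reversed reversed ⟩
    det (staircase 0ℙ m ∘ opposite) * det (staircase 0ℙ m ∘ opposite)   ≈⟨ det-opposite-square (staircase 0ℙ m) ⟩
    det (staircase 0ℙ m) * det (staircase 0ℙ m)                         ≈⟨ det-staircase-square 0ℙ m ⟩
    1#                                                  ∎
    where
    threshold-opposite : ∀ p → threshold 1ℙ p ≡ threshold 0ℙ {m} (opposite p)
    threshold-opposite p = ≡.trans (ℕ.+-∸-assoc 1 (toℕ<n p)) (≡.cong suc (≡.sym (opposite-prop p)))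
    reversed : det (staircase 1ℙ m) ≈ det (staircase 0ℙ m ∘ opposite)
    reversed = det-cong {m} λ p i → reflexive (≡.cong (λ t → indicator (t ≤ᵇ pos i)) (threshold-opposite p))

  telescope : ∀ {m} (y : Vector Carrier m) t → 1 ≤ t →
    sum {m} (λ i → indicator (t ≤ᵇ pos i) * (y ⟨ pos i ⟩ - y ⟨ suc (pos i) ⟩)) ≈ y ⟨ t ⟩
  telescope {zero}  y (suc t)    _ = refl
  telescope {suc m} y (suc zero) _ = begin
    1# * (y zero - y ⟨ 2 ⟩) + sum {m} (λ i → 1# * (y ⟨ suc (pos i) ⟩ - y ⟨ suc (suc (pos i)) ⟩))
      ≈⟨ +-cong (*-identityˡ _) (telescope (tail y) 1 (s≤s z≤n)) ⟩
    (y zero - y ⟨ 2 ⟩) + y ⟨ 2 ⟩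
      ≈⟨ +-assoc _ _ _ ⟩
    y zero + (- y ⟨ 2 ⟩ + y ⟨ 2 ⟩)
      ≈⟨ +-congˡ (-‿inverseˡ _) ⟩
    y zero + 0#
      ≈⟨ +-identityʳ _ ⟩
    y zero
      ∎
  telescope {suc m} y (suc (suc t)) _ =
    trans (+-cong (zeroˡ _) (telescope (tail y) (suc t) (s≤s z≤n))) (+-identityˡ _)

  module _ {N m : ℕ} where

    flatten : (Fin N × Fin m → Fin N × Fin m → Carrier) → Matrix (N ℕ.* m)
    flatten F i j = F (remQuot m i) (remQuot m j)

    det-flatten-1ᴹ : det (flatten λ (k , i) (s , j) → 1ᴹ k s * 1ᴹ i j) ≈ 1#
    det-flatten-1ᴹ = trans (det-cong entry) (det-1ᴹ (N ℕ.* m))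
      where
      open Injection (↔⇒↣ (*↔× {N} {m})) using (to; injective)
      entry : ∀ i j → 1ᴹ (proj₁ (to i)) (proj₁ (to j)) * 1ᴹ (proj₂ (to i)) (proj₂ (to j)) ≈ 1ᴹ i j
      entry i j with i ≟ j
      ... | yes ≡.refl = begin
        _       ≈⟨ *-cong (1ᴹ-diagonal (proj₁ (to i))) (1ᴹ-diagonal (proj₂ (to i))) ⟩
        1# * 1# ≈⟨ *-identityˡ 1# ⟩
        1#      ≈⟨ 1ᴹ-diagonal i ⟨
        1ᴹ i i  ∎
      ... | no i≢j with proj₁ (to i) ≟ proj₁ (to j)
      ...   | no ≢₁ = trans (*-congʳ (1ᴹ-off-diagonal ≢₁)) (trans (zeroˡ _) (sym (1ᴹ-off-diagonal i≢j)))
      ...   | yes ≡₁ = trans (*-congˡ (1ᴹ-off-diagonal λ ≡₂ → i≢j (injective (≡.cong₂ _,_ ≡₁ ≡₂))))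
                             (trans (zeroʳ _) (sym (1ᴹ-off-diagonal i≢j)))

    module _ (x : Fin N → Fin N → Vector Carrier m) where

      V : Fin N → Matrix m
      V r = staircase (parity (pos r)) m

      I K H : Fin N × Fin m → Fin N × Fin m → Carrier
      I (k , i) (s , j) = 1ᴹ k s * 1ᴹ i j
      K (r , i) j = sum λ k → X x i r k * I (k , i) j
      H i (s , q) = sum λ j → V s q j * K i (s , j)

      K-entry : ∀ r i s j → K (r , i) (s , j) ≈ X x i r s * 1ᴹ i j
      K-entry r i s j = begin
        sum (λ k → X x i r k * (1ᴹ k s * 1ᴹ i j))
          ≈⟨ sum-cong-≋ (λ k → solve 3 (λ x d e → x :* (d :* e) := e :* (x :* d)) refl (X x i r k) (1ᴹ k s) (1ᴹ i j)) ⟩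
        sum (λ k → 1ᴹ i j * (X x i r k * 1ᴹ k s))
          ≈⟨ *-distribˡ-sum (1ᴹ i j) (λ k → X x i r k * 1ᴹ k s) ⟨
        1ᴹ i j * sum (λ k → X x i r k * 1ᴹ k s)
          ≈⟨ trans (*-congˡ (sum-1ᴹ (X x i r) s)) (*-comm _ _) ⟩
        X x i r s * 1ᴹ i j
          ∎

      H-entry : ∀ r i s q → H (r , i) (s , q) ≈ V s q i * X x i r s
      H-entry r i s q = begin
        sum (λ j → V s q j * K (r , i) (s , j))
          ≈⟨ sum-cong-≋ (λ j → trans (*-congˡ (trans (K-entry r i s j) (*-congˡ (1ᴹ-sym i j)))) (sym (*-assoc (V s q j) _ _))) ⟩
        sum (λ j → V s q j * X x i r s * 1ᴹ j i)
          ≈⟨ sum-1ᴹ (λ j → V s q j * X x i r s) i ⟩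
        V s q i * X x i r s
          ∎

      G′-entry : ∀ r p s q → block (parity (pos r)) (parity (pos s)) (x r s) p q ≈
        sum (λ i → V r p i * H (r , i) (s , q))
      G′-entry r p s q = begin
        block π ρ (x r s) p q
          ≡⟨ block-threshold π ρ (x r s) p q ⟩
        x r s ⟨ threshold π p ⊔ threshold ρ q ⟩
          ≈⟨ telescope (x r s) (threshold π p ⊔ threshold ρ q) (ℕ.m≤n⇒m≤n⊔o (threshold ρ q) (threshold>0 π p)) ⟨
        sum (λ i → indicator (threshold π p ⊔ threshold ρ q ≤ᵇ pos i) * X x i r s)
          ≈⟨ sum-cong-≋ (λ i → *-congʳ {X x i r s} (trans (indicator-∧ (threshold π p ≤ᵇ pos i) _)
               (reflexive (≡.cong indicator (⊔-≤ᵇ (threshold π p) (threshold ρ q) (pos i)))))) ⟨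
        sum (λ i → V r p i * V s q i * X x i r s)
          ≈⟨ sum-cong-≋ (λ i → trans (*-congˡ (H-entry r i s q)) (sym (*-assoc (V r p i) _ _))) ⟨
        sum (λ i → V r p i * H (r , i) (s , q))
          ∎
        where
        π = parity (pos r)
        ρ = parity (pos s)

      det-G′ : det (G′ x) ≈ product (λ i → det (X x i))
      det-G′ = begin
        det (G′ x)
          ≈⟨ det-cong (λ i j → G′-entry (proj₁ (remQuot m i)) (proj₂ (remQuot {N} m i)) (proj₁ (remQuot m j)) (proj₂ (remQuot {N} m j))) ⟩
        det (flatten λ (r , p) j → sum λ i → V r p i * H (r , i) j)
          ≈⟨ det-block-rows *↔× V (λ i j → H i (remQuot m j)) ⟩
        v * det (flatten H)
          ≈⟨ *-congˡ (det-transpose (flatten H)) ⟨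
        v * det (flatten (flip H))
          ≈⟨ *-congˡ (det-block-rows *↔× V (λ i j → K (remQuot m j) i)) ⟩
        v * (v * det (flatten (flip K)))
          ≈⟨ *-congˡ (*-congˡ (det-transpose (flatten K))) ⟩
        v * (v * det (flatten K))
          ≈⟨ *-congˡ (*-congˡ (det-block-rows (↔-trans (*↔× {N} {m}) (×-comm _ _)) (X x) (λ (i , k) j → I (k , i) (remQuot m j)))) ⟩
        v * (v * (product (λ i → det (X x i)) * det (flatten I)))
          ≈⟨ *-congˡ (*-congˡ (trans (*-congˡ det-flatten-1ᴹ) (*-identityʳ _))) ⟩
        v * (v * product (λ i → det (X x i)))
          ≈⟨ *-assoc v v _ ⟨
        v * v * product (λ i → det (X x i))
          ≈⟨ *-congʳ (product-square (λ r → det (V r)) (λ r → det-staircase-square (parity (pos r)) m)) ⟩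
        1# * product (λ i → det (X x i))
          ≈⟨ *-identityˡ _ ⟩
        product (λ i → det (X x i))
          ∎
        where v = product (λ r → det (V r))

theorem4p2 : ∀ {c ℓ} (R : CommutativeRing c ℓ) →
    let open CommutativeRing R
        open Matrices R in
    (N m : ℕ) → 2 ≤ N → 1 ≤ m →
    (x : Fin N → Fin N → Vector Carrier m) →
    det (G′ x) ≈ product (λ i → det (X x i))
theorem4p2 R N m _ _ x = det-G′ R x
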